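{- Let $F:\mathsf{State}\to\mathsf{State}$ be a closure function for a circuit and let $G=(V,E,\mathrm{ant},\mathrm{cons})$ be an assertion graph for this circuit. The scalar GSTE-algorithm is sound and complete with respect to simple satisfaction: it returns True on input $(F,G)$ if and only if $F\models_S G$ ($F$ simply satisfies $G$).
   Context: **Values and states.** $\mathbb V=\{0,1,\mathsf X,\mathsf T\}$ is the lattice with least element $\mathsf X$, greatest element $\mathsf T$, and $0,1$ incomparable ($\mathsf X\le 0,1\le \mathsf T$); $\sqcup,\sqcap$ denote least upper bound and greatest lower bound. A circuit has a finite set of nodes $\mathcal N$ and a subset $\mathcal S\subseteq\mathcal N$ of register outputs; the register with output $n\in\mathcal S$ has input node $n'\in\mathcal N$. A circuit state is a function $s:\mathcal N\to\mathbb V$; the set of states is $\mathsf{State}$, ordered pointwise. A closure function is a map $F:\mathsf{State}\to\mathsf{State}$ that is monotonic, idempotent ($F(F(s))=F(s)$) and extensive ($s\le F(s)$). For a state $s$, $\mathrm{next}(s)(n)=s(n')$ if $n\in\mathcal S$ and $\mathrm{next}(s)(n)=\mathsf X$ otherwise. **Sequence graphs.** A sequence graph is a triple $(V,E,\Sigma)$ with $V$ a finite set of vertices containing the initial vertex $\mathsf{init}$, $E$ a finite set of directed edges (each $e$ has $\mathrm{start}(e),\mathrm{end}(e)\in V$; multiple edges allowed), and $\Sigma:E\to\mathsf{State}$. It is usually identified with $\Sigma$. Two sequence graphs have the same shape if they have the same $V$ and $E$; same-shape graphs are ordered pointwise. An edge is initial if it starts in $\mathsf{init}$; $\mathrm{in}(e)=\{e'\in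 E: \mathrm{end}(e')=\mathrm{start}(e)\}$. Only graphs in which every vertex and edge is reachable from $\mathsf{init}$ are considered. For a sequence graph $\Sigma$ and a same-shape $\Delta$ define $$F^{\circ}_{\Sigma}(\Delta)(e)=\begin{cases}F(\Sigma(e)) & e\text{ initial}\\ F\big(\Sigma(e)\sqcup \mathop{\sqcap}\limits_{i\in \mathrm{in}(e)}\mathrm{next}(\Delta(i))\big)&\text{otherwise,}\end{cases}$$ and let $F^{\circ}(\Sigma)$ be the greatest fixpoint of $\Delta\mapsto F^\circ_\Sigma(\Delta)$. A trajectory graph of $F$ is a sequence graph $\Sigma$ with $F^\circ(\Sigma)=\Sigma$. **Assertion graphs.** $W$ is a set of symbolic constants. GTEL formulas are given by $f::= n\ \mathbf{is}\ 0\mid n\ \mathbf{is}\ 1\mid f_1\ \mathbf{and}\ f_2\mid P\to f$, with $n\in\mathcal N$ and $P$ a Boolean propositional formula over $W$. For $\phi:W\to\{0,1\}$ and a state $s$: $\phi,s\models n\ \mathbf{is}\ b$ iff $b\le s(n)$; $\phi,s\models f_1\ \mathbf{and}\ f_2$ iff both hold; $\phi,s\models P\to f$ iff ($\phi$ satisfies $P$ implies $\phi,s\models f$). An assertion graph is $G=(V,E,\mathrm{ant},\mathrm{cons})$ with $V,E$ as for sequence graphs (including reachability) and $\mathrm{ant},\mathrm{cons}:E\to$ GTEL. For $f\in\{\mathrm{ant},\mathrm{cons}\}$ and a sequence graph $\Sigma$ of the same shape as $G$ (same $V$, $E$), $\phi,\Sigma\models f$ means $\phi,\Sigma(e)\models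 f(e)$ for all $e\in E$. $F$ simply satisfies $G$, written $F\models_S G$, iff for all $\phi:W\to\{0,1\}$ and all trajectory graphs $\Sigma$ of $F$ of the same shape as $G$: $\phi,\Sigma\models\mathrm{ant}$ implies $\phi,\Sigma\models\mathrm{cons}$. **Defining sequence graph.** For $f\in\{\mathrm{ant},\mathrm{cons}\}$ and $\phi$, the sequence graph ${}^\phi[f]$ is ${}^\phi[f](e)={}^\phi[f(e)]_{\rm state}$, where ${}^\phi[m\ \mathbf{is}\ b]_{\rm state}(n)=b$ if $m=n$ and $\mathsf X$ otherwise; ${}^\phi[f_1\ \mathbf{and}\ f_2]_{\rm state}={}^\phi[f_1]_{\rm state}\sqcup{}^\phi[f_2]_{\rm state}$; ${}^\phi[P\to f]_{\rm state}={}^\phi[f]_{\rm state}$ if $\phi$ satisfies $P$, and the all-$\mathsf X$ state otherwise. **Scalar GSTE-algorithm.** For a sequence graph $\Sigma$ let $\Delta^\Sigma_k=(F^\circ_\Sigma)^k(\mathsf T)$, where $\mathsf T$ is the same-shape sequence graph with value $\mathsf T$ at every node of every edge, and let $\Delta^\Sigma_*$ be the limit (eventually constant value) of this descending sequence. On input $(F,G)$ the algorithm computes, for every $\phi:W\to\{0,1\}$, the graph $\Delta_*^{\Sigma}$ with $\Sigma={}^\phi[\mathrm{ant}]$, and checks whether ${}^\phi[\mathrm{cons}]\le\Delta_*^{\Sigma}$. If the check fails for some $\phi$ it returns False; otherwise it returns True. -}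

module Defs where

open import Algebra.Definitions using (IdempotentFun)
open import Data.Bool using (Bool; true; false; not; _∧_; _∨_; if_then_else_)
open import Data.Fin using (Fin; _≟_)
open import Data.Fin.Subset using (Subset; _∈_)
open import Data.Fin.Subset.Properties using (_∈?_)
open import Data.List using (List; allFin; filter; foldr)
open import Data.Nat as ℕ using (ℕ)
open import Data.Nat.GeneralisedArithmetic using (fold)
open import Data.Product using (∃-syntax; _×_; _,_)
open import Data.Vec.Functional using (Vector; replicate; zipWith)
open import Data.Vec.Functional.Relation.Binary.Pointwise using (Pointwise)
open import Relation.Binary.Construct.Closure.ReflexiveTransitive using (Star)
open import Relation.Binary.Definitions using (Monotonic₁; Transitive; Antisymmetric)
open import Relation.Binary.Lattice using (Supremum; Infimum; IsBoundedLattice)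
open import Relation.Binary.PropositionalEquality using (_≡_; refl; isEquivalence)
open import Relation.Nullary using (¬_; yes; no; does)

infix  4 _≤_ _≤ᴳ_ _≈ᴳ_
infixr 6 _⊔_
infixr 7 _⊓_

data 𝕍 : Set where
  𝟎 𝟏 X T : 𝕍

data _≤_ : 𝕍 → 𝕍 → Set where
  X≤  : ∀ {v} → X ≤ v
  ≤T  : ∀ {v} → v ≤ T
  rfl : ∀ {v} → v ≤ v

_⊔_ : 𝕍 → 𝕍 → 𝕍
X ⊔ v = v
T ⊔ _ = T
𝟎 ⊔ X = 𝟎
𝟎 ⊔ 𝟎 = 𝟎
𝟎 ⊔ 𝟏 = T
𝟎 ⊔ T = T
𝟏 ⊔ X = 𝟏
𝟏 ⊔ 𝟎 = T
𝟏 ⊔ 𝟏 = 𝟏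
𝟏 ⊔ T = T

_⊓_ : 𝕍 → 𝕍 → 𝕍
X ⊓ _ = X
T ⊓ v = v
𝟎 ⊓ X = X
𝟎 ⊓ 𝟎 = 𝟎
𝟎 ⊓ 𝟏 = X
𝟎 ⊓ T = 𝟎
𝟏 ⊓ X = X
𝟏 ⊓ 𝟎 = X
𝟏 ⊓ 𝟏 = 𝟏
𝟏 ⊓ T = 𝟏

≤-trans : Transitive _≤_
≤-trans X≤  _   = X≤
≤-trans ≤T  ≤T  = ≤T
≤-trans ≤T  rfl = ≤T
≤-trans rfl q   = q

≤-antisym : Antisymmetric _≡_ _≤_
≤-antisym X≤  X≤  = refl
≤-antisym X≤  rfl = refl
≤-antisym ≤T  ≤T  = refl
≤-antisym ≤T  rfl = refl
≤-antisym rfl _   = refl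

⊔-supremum : Supremum _≤_ _⊔_
⊔-supremum X y = X≤ , rfl , λ _ _ q → q
⊔-supremum T y = rfl , ≤T , λ _ p _ → p
⊔-supremum 𝟎 X = rfl , X≤ , λ _ p _ → p
⊔-supremum 𝟎 𝟎 = rfl , rfl , λ _ p _ → p
⊔-supremum 𝟎 𝟏 = ≤T , ≤T , λ { _ ≤T _ → rfl ; _ rfl () }
⊔-supremum 𝟎 T = ≤T , rfl , λ _ _ q → q
⊔-supremum 𝟏 X = rfl , X≤ , λ _ p _ → p
⊔-supremum 𝟏 𝟎 = ≤T , ≤T , λ { _ ≤T _ → rfl ; _ rfl () }
⊔-supremum 𝟏 𝟏 = rfl , rfl , λ _ p _ → p
⊔-supremum 𝟏 T = ≤T , rfl , λ _ _ q → q

⊓-infimum : Infimum _≤_ _⊓_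
⊓-infimum X y = rfl , X≤ , λ _ p _ → p
⊓-infimum T y = ≤T , rfl , λ _ _ q → q
⊓-infimum 𝟎 X = X≤ , rfl , λ _ _ q → q
⊓-infimum 𝟎 𝟎 = rfl , rfl , λ _ p _ → p
⊓-infimum 𝟎 𝟏 = X≤ , X≤ , λ { _ X≤ _ → rfl ; _ rfl () }
⊓-infimum 𝟎 T = rfl , ≤T , λ _ p _ → p
⊓-infimum 𝟏 X = X≤ , rfl , λ _ _ q → q
⊓-infimum 𝟏 𝟎 = X≤ , X≤ , λ { _ X≤ _ → rfl ; _ rfl () }
⊓-infimum 𝟏 𝟏 = rfl , rfl , λ _ p _ → p
⊓-infimum 𝟏 T = rfl , ≤T , λ _ p _ → p

𝕍-isBoundedLattice : IsBoundedLattice _≡_ _≤_ _⊔_ _⊓_ T X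
𝕍-isBoundedLattice = record
  { isLattice = record
    { isPartialOrder = record
      { isPreorder = record
        { isEquivalence = isEquivalence
        ; reflexive     = λ { refl → rfl }
        ; trans         = ≤-trans
        }
      ; antisym = ≤-antisym
      }
    ; supremum = ⊔-supremum
    ; infimum  = ⊓-infimum
    }
  ; maximum = λ _ → ≤T
  ; minimum = λ _ → X≤
  }

⌜_⌝ : Bool → 𝕍
⌜ false ⌝ = 𝟎
⌜ true  ⌝ = 𝟏

-- `input n _` is the input node n' of the register with output n.
record Circuit : Set where
  field
    nodes     : ℕ
    registers : Subset nodes
    input     : ∀ n → n ∈ registers → Fin nodes

  Node State : Set
  Node  = Fin nodes
  State = Vector 𝕍 nodes

  next : State → State
  next s n with n ∈? registers
  ... | yes n∈S = s (input n n∈S)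
  ... | no  _   = X

open Circuit public using (Node; State)

-- There is no function extensionality, so states and graphs are compared up
-- to pointwise equality.  A state is a vector over the nodes of a circuit, a
-- sequence graph a vector of states over the edges of a shape.
module _ {n : ℕ} where

  infix  4 _≈ˢ_ _≤ˢ_
  infixr 6 _⊔ˢ_
  infixr 7 _⊓ˢ_

  _≈ˢ_ _≤ˢ_ : Vector 𝕍 n → Vector 𝕍 n → Set
  _≈ˢ_ = Pointwise _≡_
  _≤ˢ_ = Pointwise _≤_

  _⊔ˢ_ _⊓ˢ_ : Vector 𝕍 n → Vector 𝕍 n → Vector 𝕍 n
  _⊔ˢ_ = zipWith _⊔_
  _⊓ˢ_ = zipWith _⊓_

  𝐗ˢ 𝐓ˢ : Vector 𝕍 n
  𝐗ˢ = replicate n X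
  𝐓ˢ = replicate n T

_≈ᴳ_ _≤ᴳ_ : ∀ {n m} → Vector (Vector 𝕍 n) m → Vector (Vector 𝕍 n) m → Set
_≈ᴳ_ = Pointwise _≈ˢ_
_≤ᴳ_ = Pointwise _≤ˢ_

record IsClosureFunction (C : Circuit) (F : State C → State C) : Set where
  field
    monotonic  : Monotonic₁ _≤ˢ_ _≤ˢ_ F
    idempotent : IdempotentFun _≈ˢ_ F
    extensive  : ∀ s → s ≤ˢ F s

-- The underlying multigraph (V , E) of sequence graphs and assertion graphs.
-- Only reachability of vertices is required: an edge is reachable as soon as
-- its start is.
record Shape : Set where
  field
    vertices edges : ℕ
    init           : Fin vertices
    start end      : Fin edges → Fin vertices
    reachable      : ∀ v → Star (λ u w → ∃[ e ] start e ≡ u × end e ≡ w) init v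

  Edge : Set
  Edge = Fin edges

  incoming : Edge → List Edge
  incoming e = filter (λ i → end i ≟ start e) (allFin edges)

open Shape public using (Edge)

SequenceGraph : Circuit → Shape → Set
SequenceGraph C S = Vector (State C) (Shape.edges S)

module Trajectories (C : Circuit) (S : Shape) (F : State C → State C) where

  open Circuit C using (next)
  open Shape S using (init; start; incoming)

  private
    Graph : Set
    Graph = SequenceGraph C S

  𝐓ᴳ : Graph
  𝐓ᴳ = replicate _ 𝐓ˢ

  -- The greatest lower bound of next (Δ i) over all i in in(e).
  ⨅next : Graph → Edge S → State C
  ⨅next Δ e = foldr (λ i s → next (Δ i) ⊓ˢ s) 𝐓ˢ (incoming e)

  F°[_] : Graph → Graph → Graph
  F°[ Σ ] Δ e with start e ≟ init
  ... | yes _ = F (Σ e)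
  ... | no  _ = F (Σ e ⊔ˢ ⨅next Δ e)

  record IsGreatestFixpoint (H : Graph → Graph) (Δ : Graph) : Set where
    field
      fixpoint : H Δ ≈ᴳ Δ
      greatest : ∀ Γ → H Γ ≈ᴳ Γ → Γ ≤ᴳ Δ

  -- F°(Σ) is given as a relation, as greatest fixpoints are unique only up
  -- to _≈ᴳ_: `F°⟨ Σ ⟩≐ Δ` says that F°(Σ) equals Δ.
  F°⟨_⟩≐_ : Graph → Graph → Set
  F°⟨ Σ ⟩≐ Δ = IsGreatestFixpoint F°[ Σ ] Δ

  IsTrajectoryGraph : Graph → Set
  IsTrajectoryGraph Σ = F°⟨ Σ ⟩≐ Σ

  Δ[_] : Graph → ℕ → Graph
  Δ[ Σ ] = fold 𝐓ᴳ F°[ Σ ]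

  -- Δ⋆ is the eventually constant value of the sequence Δ[ Σ ].
  Δ⋆[_]≐_ : Graph → Graph → Set
  Δ⋆[ Σ ]≐ Δ⋆ = ∃[ K ] (∀ k → K ℕ.≤ k → Δ[ Σ ] k ≈ᴳ Δ⋆)

data Formula (W : Set) : Set where
  var       : W → Formula W
  ⊤ᶠ ⊥ᶠ     : Formula W
  ¬ᶠ_       : Formula W → Formula W
  _∧ᶠ_ _∨ᶠ_ : Formula W → Formula W → Formula W

eval : ∀ {W} → (W → Bool) → Formula W → Bool
eval φ (var w)  = φ w
eval φ ⊤ᶠ       = true
eval φ ⊥ᶠ       = false
eval φ (¬ᶠ P)   = not (eval φ P)
eval φ (P ∧ᶠ Q) = eval φ P ∧ eval φ Q
eval φ (P ∨ᶠ Q) = eval φ P ∨ eval φ Q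

data GTEL (C : Circuit) (W : Set) : Set where
  _is_  : Node C → Bool → GTEL C W
  _and_ : GTEL C W → GTEL C W → GTEL C W
  _⟶_   : Formula W → GTEL C W → GTEL C W

_,_⊨_ : ∀ {C W} → (W → Bool) → State C → GTEL C W → Set
φ , s ⊨ (n is b)  = ⌜ b ⌝ ≤ s n
φ , s ⊨ (f and g) = (φ , s ⊨ f) × (φ , s ⊨ g)
φ , s ⊨ (P ⟶ f)   = eval φ P ≡ true → φ , s ⊨ f

⟦_⟧ˢ : ∀ {C W} → GTEL C W → (W → Bool) → State C
⟦ m is b ⟧ˢ  φ n = if does (m ≟ n) then ⌜ b ⌝ else X
⟦ f and g ⟧ˢ φ   = ⟦ f ⟧ˢ φ ⊔ˢ ⟦ g ⟧ˢ φ
⟦ P ⟶ f ⟧ˢ   φ   = if eval φ P then ⟦ f ⟧ˢ φ else 𝐗ˢ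

record AssertionGraph (C : Circuit) (W : Set) : Set where
  field
    shape    : Shape
    ant cons : Edge shape → GTEL C W

module _ {C : Circuit} {W : Set} (F : State C → State C) (G : AssertionGraph C W) where

  open AssertionGraph G
  open Trajectories C shape F

  -- Satisfaction of ant or cons by a sequence graph of the same shape as G.
  _,_⊨ᴳ_ : (W → Bool) → SequenceGraph C shape → (Edge shape → GTEL C W) → Set
  φ , Σ ⊨ᴳ f = ∀ e → φ , Σ e ⊨ f e

  SimplySatisfies : Set
  SimplySatisfies = ∀ φ Σ → IsTrajectoryGraph Σ → φ , Σ ⊨ᴳ ant → φ , Σ ⊨ᴳ cons

  -- The defining sequence graph of ant or cons.
  ⟦_⟧ᴳ : (Edge shape → GTEL C W) → (W → Bool) → SequenceGraph C shape
  ⟦ f ⟧ᴳ φ e = ⟦ f e ⟧ˢ φ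

  -- The input-output relation of the scalar GSTE-algorithm.  As W is an
  -- arbitrary set, the loop over all φ is a quantifier.  For either output,
  -- the limits inspected by the algorithm are required to exist.
  data ScalarGSTE : Bool → Set where
    returnsTrue  : (∀ φ → ∃[ Δ ] (Δ⋆[ ⟦ ant ⟧ᴳ φ ]≐ Δ) × ⟦ cons ⟧ᴳ φ ≤ᴳ Δ) →
                   ScalarGSTE true
    returnsFalse : ∀ φ → (∃[ Δ ] (Δ⋆[ ⟦ ant ⟧ᴳ φ ]≐ Δ) × ¬ (⟦ cons ⟧ᴳ φ ≤ᴳ Δ)) →
                   ScalarGSTE false

{-# OPTIONS --safe #-}

-- The limit Δ⋆ of the iteration from 𝐓 is the greatest post-fixpoint of F°_Σ:
-- a descending sequence stabilises because a sum of heights in 𝕍 cannot drop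
-- forever, and every post-fixpoint stays below all iterates.
--
-- The limit Δ⋆ for Σ is itself a trajectory graph: any Γ above Δ⋆ satisfies
-- F°_Δ⋆(Γ) = F°_Σ(Γ), because F is idempotent and Δ⋆ = F°_Σ(Δ⋆) ≤ F°_Σ(Γ).
-- Hence Δ⋆ is the least trajectory graph above Σ, and since a graph satisfies
-- ant (or cons) exactly if it lies above the defining sequence graph, simple
-- satisfaction amounts to the check on Δ⋆ alone.
module Submission where

open import Defs
open import Data.Bool using (Bool; true; false)
open import Data.Fin using (zero; suc; _≟_)
open import Data.Fin.Subset.Properties using (_∈?_)
open import Data.List using ([]; _∷_; foldr)
open import Data.Nat as ℕ using (ℕ; zero; suc; z≤n; s≤s)
import Data.Nat.Properties as ℕ
open import Data.Nat.GeneralisedArithmetic using (fold)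
open import Data.Product using (∃-syntax; _×_; _,_)
open import Data.Vec.Functional using (Vector)
import Data.Vec.Functional.Relation.Binary.Pointwise.Properties as Pointwise
open import Data.Vec.Functional.Relation.Binary.Pointwise using (Pointwise)
open import Function using (_∘_)
import Level
open import Function.Bundles using (_⇔_; mk⇔)
open import Relation.Binary.Bundles using (Poset)
open import Relation.Binary.Definitions using (Monotonic₁; Maximum)
open import Relation.Binary.Lattice using (BoundedLattice)
import Relation.Binary.Lattice.Properties.JoinSemilattice as JoinProperties
import Relation.Binary.Lattice.Properties.MeetSemilattice as MeetProperties
import Relation.Binary.Properties.Poset as PosetProperties
open import Relation.Binary.PropositionalEquality using (refl)
open import Algebra.Properties.Monoid.Sum ℕ.+-0-monoid using (sum)
open import Relation.Nullary using (yes; no; contradiction)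

-- Ranked posets and their pointwise powers.

record Rank {c ℓ₁ ℓ₂} (P : Poset c ℓ₁ ℓ₂) : Set (c Level.⊔ ℓ₂) where
  open Poset P renaming (_≤_ to _⊑_)
  field
    rank         : Carrier → ℕ
    rank-mono    : Monotonic₁ _⊑_ ℕ._≤_ rank
    -- Strictness of `rank` in positive form: whether a step of a chain is strict is decided by
    -- comparing two natural numbers, never the elements themselves.
    rank-reflect : ∀ {x y} → x ⊑ y → rank y ℕ.≤ rank x → y ⊑ x

pointwise : ∀ {c ℓ₁ ℓ₂} → Poset c ℓ₁ ℓ₂ → ℕ → Poset c ℓ₁ ℓ₂
pointwise P n = record
  { Carrier        = Vector Carrier n
  ; _≈_            = Pointwise _≈_
  ; _≤_            = Pointwise _⊑_
  ; isPartialOrder = record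
    { isPreorder = record
      { isEquivalence = Pointwise.isEquivalence isEquivalence n
      ; reflexive     = λ x≈y i → reflexive (x≈y i)
      ; trans         = λ x⊑y y⊑z i → trans (x⊑y i) (y⊑z i)
      }
    ; antisym = λ x⊑y y⊑x i → antisym (x⊑y i) (y⊑x i)
    }
  }
  where open Poset P renaming (_≤_ to _⊑_)

sum-mono : ∀ {n} → Monotonic₁ (Pointwise ℕ._≤_) ℕ._≤_ (sum {n})
sum-mono {zero}  f≤g = z≤n
sum-mono {suc n} f≤g = ℕ.+-mono-≤ (f≤g zero) (sum-mono (f≤g ∘ suc))

-- With every summand of `f` at most that of `g`, equal totals leave no slack: bounding the tail and
-- cancelling it settles the head, and conversely.
sum-reflect : ∀ {n} {f g : Vector ℕ n} → Pointwise ℕ._≤_ f g →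
              sum g ℕ.≤ sum f → Pointwise ℕ._≤_ g f
sum-reflect {f = f} {g} f≤g Σg≤Σf zero =
  ℕ.+-cancelʳ-≤ (sum (g ∘ suc)) _ _
    (ℕ.≤-trans Σg≤Σf (ℕ.+-monoʳ-≤ (f zero) (sum-mono (f≤g ∘ suc))))
sum-reflect {f = f} {g} f≤g Σg≤Σf (suc i) =
  sum-reflect (f≤g ∘ suc)
    (ℕ.+-cancelˡ-≤ (g zero) _ _
      (ℕ.≤-trans Σg≤Σf (ℕ.+-monoˡ-≤ (sum (f ∘ suc)) (f≤g zero)))) i

pointwise-rank : ∀ {c ℓ₁ ℓ₂} {P : Poset c ℓ₁ ℓ₂} → Rank P → ∀ n → Rank (pointwise P n)
pointwise-rank R n = record
  { rank         = λ x → sum (rank ∘ x)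
  ; rank-mono    = λ x⊑y → sum-mono (rank-mono ∘ x⊑y)
  ; rank-reflect = λ x⊑y r i →
      rank-reflect (x⊑y i) (sum-reflect (rank-mono ∘ x⊑y) r i)
  }
  where open Rank R

-- Descending iteration of a monotone map from the top element.

module Iteration
  {c ℓ₁ ℓ₂} (P : Poset c ℓ₁ ℓ₂) (R : Rank P)
  {⊤ : Poset.Carrier P} (maximum : Maximum (Poset._≤_ P) ⊤)
  {H : Poset.Carrier P → Poset.Carrier P}
  (H-mono : Monotonic₁ (Poset._≤_ P) (Poset._≤_ P) H)
  where

  open Poset P renaming (_≤_ to _⊑_)
  open Rank R

  iterate : ℕ → Carrier
  iterate = fold ⊤ H

  IsLimit : Carrier → Set ℓ₁
  IsLimit x = ∃[ K ] (∀ k → K ℕ.≤ k → iterate k ≈ x)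

  iterate-antitone : ∀ {j k} → j ℕ.≤ k → iterate k ⊑ iterate j
  iterate-antitone z≤n       = maximum _
  iterate-antitone (s≤s j≤k) = H-mono (iterate-antitone j≤k)

  postfixpoint⊑iterate : ∀ {x} → x ⊑ H x → ∀ k → x ⊑ iterate k
  postfixpoint⊑iterate x⊑Hx zero    = maximum _
  postfixpoint⊑iterate x⊑Hx (suc k) = trans x⊑Hx (H-mono (postfixpoint⊑iterate x⊑Hx k))

  iterate-stabilises : ∃[ K ] (iterate K ⊑ iterate (suc K))
  iterate-stabilises = go (rank ⊤) 0 ℕ.≤-refl
    where
    descends : ∀ k → iterate (suc k) ⊑ iterate k
    descends k = iterate-antitone (ℕ.n≤1+n k)

    -- `fuel` bounds the rank of the current iterate. Each strict descent lowers that rank, and at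
    -- rank 0 no further drop is possible.
    go : ∀ fuel k → rank (iterate k) ℕ.≤ fuel → ∃[ K ] (iterate K ⊑ iterate (suc K))
    go fuel k r≤fuel with rank (iterate k) ℕ.≤? rank (iterate (suc k))
    ... | yes r≤r′ = k , rank-reflect (descends k) r≤r′
    go zero       k r≤0      | no r≰r′ = contradiction (ℕ.≤-trans r≤0 z≤n) r≰r′
    go (suc fuel) k r≤1+fuel | no r≰r′ =
      go fuel (suc k) (ℕ.s≤s⁻¹ (ℕ.≤-trans (ℕ.≰⇒> r≰r′) r≤1+fuel))

  limit-exists : ∃[ x ] IsLimit x
  limit-exists with K , K⊑1+K ← iterate-stabilises =
    -- `K⊑1+K` makes `iterate K` a post-fixpoint of `H`, hence a lower bound of all iterates; this
    -- one comparison therefore fixes the whole tail.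
    iterate K , K , λ k K≤k →
      antisym (iterate-antitone K≤k) (postfixpoint⊑iterate K⊑1+K k)

  limit-fixpoint : ∀ {x} → IsLimit x → H x ≈ x
  limit-fixpoint (K , lim) =
    Eq.trans (mono⇒cong H-mono (Eq.sym (lim K ℕ.≤-refl))) (lim (suc K) (ℕ.n≤1+n K))
    where open PosetProperties P using (mono⇒cong)

  postfixpoint⊑limit : ∀ {x y} → IsLimit x → y ⊑ H y → y ⊑ x
  postfixpoint⊑limit (K , lim) y⊑Hy =
    trans (postfixpoint⊑iterate y⊑Hy K) (reflexive (lim K ℕ.≤-refl))

𝕍-boundedLattice : BoundedLattice _ _ _
𝕍-boundedLattice = record { isBoundedLattice = 𝕍-isBoundedLattice }

open BoundedLattice 𝕍-boundedLattice
  using (x≤x∨y; y≤x∨y; ∨-least; joinSemilattice; meetSemilattice)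
  renaming (poset to 𝕍-poset)
open JoinProperties joinSemilattice using () renaming (∨-monotonic to ⊔-mono)
open MeetProperties meetSemilattice using () renaming (∧-monotonic to ⊓-mono)

𝕍-rank : Rank 𝕍-poset
𝕍-rank = record { rank = rank ; rank-mono = mono ; rank-reflect = reflect }
  where
  rank : 𝕍 → ℕ
  rank X = 0
  rank 𝟎 = 1
  rank 𝟏 = 1
  rank T = 2

  mono : Monotonic₁ _≤_ ℕ._≤_ rank
  mono X≤       = z≤n
  mono rfl      = ℕ.≤-refl
  mono (≤T {𝟎}) = s≤s z≤n
  mono (≤T {𝟏}) = s≤s z≤n
  mono (≤T {X}) = z≤n
  mono (≤T {T}) = ℕ.≤-refl

  reflect : ∀ {x y} → x ≤ y → rank y ℕ.≤ rank x → y ≤ x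
  reflect rfl      _ = rfl
  reflect (X≤ {X}) _ = rfl
  reflect (≤T {T}) _ = rfl
  reflect (≤T {𝟎}) (s≤s ())
  reflect (≤T {𝟏}) (s≤s ())

graphPoset : ℕ → ℕ → Poset _ _ _
graphPoset n m = pointwise (pointwise 𝕍-poset n) m

graphRank : ∀ n m → Rank (graphPoset n m)
graphRank n m = pointwise-rank (pointwise-rank 𝕍-rank n) m

-- Formulas as lower bounds on states.

module _ {C : Circuit} where

  open Circuit C using (registers; next)

  next-mono : Monotonic₁ _≤ˢ_ _≤ˢ_ next
  next-mono s≤t n with n ∈? registers
  ... | yes _ = s≤t _
  ... | no  _ = rfl

  module _ {W : Set} {φ : W → Bool} where

    -- Each formula only imposes lower bounds on node values: conjunction joins them and a false
    -- guard imposes none. With the converse below, the satisfying states are exactly those above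
    -- the defining state.
    ⊨⇒⟦⟧≤ : ∀ {s} (f : GTEL C W) → φ , s ⊨ f → ⟦ f ⟧ˢ φ ≤ˢ s
    ⊨⇒⟦⟧≤ (m is b) b≤sm n with m ≟ n
    ... | yes refl = b≤sm
    ... | no  _    = X≤
    ⊨⇒⟦⟧≤ (f and g) (s⊨f , s⊨g) n = ∨-least (⊨⇒⟦⟧≤ f s⊨f n) (⊨⇒⟦⟧≤ g s⊨g n)
    ⊨⇒⟦⟧≤ (P ⟶ f) s⊨f with eval φ P
    ... | true  = ⊨⇒⟦⟧≤ f (s⊨f refl)
    ... | false = λ _ → X≤

    ⟦⟧≤⇒⊨ : ∀ {s} (f : GTEL C W) → ⟦ f ⟧ˢ φ ≤ˢ s → φ , s ⊨ f
    ⟦⟧≤⇒⊨ (m is b) f≤s with m ≟ m | f≤s m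
    ... | yes _   | b≤sm = b≤sm
    ... | no  m≢m | _    = contradiction refl m≢m
    ⟦⟧≤⇒⊨ (f and g) fg≤s =
      ⟦⟧≤⇒⊨ f (λ n → ≤-trans (x≤x∨y _ _) (fg≤s n)) ,
      ⟦⟧≤⇒⊨ g (λ n → ≤-trans (y≤x∨y (⟦ f ⟧ˢ φ n) _) (fg≤s n))
    ⟦⟧≤⇒⊨ (P ⟶ f) f≤s P-true with true ← eval φ P = ⟦⟧≤⇒⊨ f f≤s

-- Greatest fixpoints and trajectory graphs of a closure function.

module _ {C : Circuit} {F : State C → State C} (closure : IsClosureFunction C F)
         (S : Shape) where

  open Circuit C using (nodes; next)
  open Shape S using (edges; init; start; incoming)
  open Trajectories C S F
  open IsClosureFunction closure
  open IsGreatestFixpoint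
  open Poset (graphPoset nodes edges) using (antisym; reflexive; trans; module Eq)
    renaming (refl to ≤ᴳ-refl)

  closure-least : ∀ {s t} → s ≤ˢ F t → F s ≤ˢ F t
  closure-least {t = t} s≤Ft n =
    ≤-trans (monotonic s≤Ft n) (Poset.reflexive 𝕍-poset (idempotent t n))

  ⨅next-mono : ∀ {Γ Δ} → Γ ≤ᴳ Δ → ∀ e → ⨅next Γ e ≤ˢ ⨅next Δ e
  ⨅next-mono {Γ} {Δ} Γ≤Δ e = go (incoming e)
    where
    -- The fold of `⨅next` over an arbitrary list, so that induction on the list is possible.
    ⨅ : SequenceGraph C S → _ → State C
    ⨅ Θ = foldr (λ i s → next (Θ i) ⊓ˢ s) 𝐓ˢ

    go : ∀ es → ⨅ Γ es ≤ˢ ⨅ Δ es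
    go []       n = rfl
    go (i ∷ es) n = ⊓-mono (next-mono {C} (Γ≤Δ i) n) (go es n)

  F°-mono : ∀ {Σ Σ′ Γ Δ} → Σ ≤ᴳ Σ′ → Γ ≤ᴳ Δ → F°[ Σ ] Γ ≤ᴳ F°[ Σ′ ] Δ
  F°-mono Σ≤Σ′ Γ≤Δ e with start e ≟ init
  ... | yes _ = monotonic (Σ≤Σ′ e)
  ... | no  _ = monotonic λ n → ⊔-mono (Σ≤Σ′ e n) (⨅next-mono Γ≤Δ e n)

  F°-extensive : ∀ Σ Γ → Σ ≤ᴳ F°[ Σ ] Γ
  F°-extensive Σ Γ e with start e ≟ init
  ... | yes _ = extensive (Σ e)
  ... | no  _ = λ n → ≤-trans (x≤x∨y _ _) (extensive _ n)

  -- At a non-initial edge `F°[ Σ ] Γ` is a closed state above both `Δ` (by hypothesis) and the meet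
  -- over incoming edges, so it is above the closure of their join. At an initial edge the bound on
  -- `Δ` suffices.
  F°-least : ∀ {Σ Δ Γ} → Δ ≤ᴳ F°[ Σ ] Γ → F°[ Δ ] Γ ≤ᴳ F°[ Σ ] Γ
  F°-least {Σ} {Δ} {Γ} Δ≤F°Γ e with start e ≟ init | Δ≤F°Γ e
  ... | yes _ | Δe≤ = closure-least Δe≤
  ... | no  _ | Δe≤ = closure-least λ n →
    ∨-least (Δe≤ n) (≤-trans (y≤x∨y (Σ e n) _) (extensive _ n))

  module F°Iteration (Σ : SequenceGraph C S) =
    Iteration (graphPoset nodes edges) (graphRank nodes edges) {𝐓ᴳ} (λ _ _ _ → ≤T)
      {F°[ Σ ]} (F°-mono (≤ᴳ-refl {Σ}))
  open F°Iteration

  fixpoint-above : ∀ {Σ Δ} → F°[ Σ ] Δ ≈ᴳ Δ → Σ ≤ᴳ Δ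
  fixpoint-above {Σ} {Δ} fix = trans (F°-extensive Σ Δ) (reflexive fix)

  limit-isGreatestFixpoint : ∀ {Σ Δ} → Δ⋆[ Σ ]≐ Δ → F°⟨ Σ ⟩≐ Δ
  limit-isGreatestFixpoint {Σ} lim = record
    { fixpoint = limit-fixpoint Σ lim
    ; greatest = λ Γ fix → postfixpoint⊑limit Σ lim (reflexive (Eq.sym fix))
    }

  -- `greatest` compares with fixpoints only; the limit of the iteration is a fixpoint above `Γ` and
  -- bridges the gap.
  postfixpoint≤greatestFixpoint : ∀ {Σ Δ Γ} → F°⟨ Σ ⟩≐ Δ → Γ ≤ᴳ F°[ Σ ] Γ → Γ ≤ᴳ Δ
  postfixpoint≤greatestFixpoint {Σ} gfp Γ≤F°Γ with D , lim ← limit-exists Σ =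
    trans (postfixpoint⊑limit Σ lim Γ≤F°Γ) (greatest gfp D (limit-fixpoint Σ lim))

  greatestFixpoint-isTrajectoryGraph : ∀ {Σ Δ} → F°⟨ Σ ⟩≐ Δ → IsTrajectoryGraph Δ
  greatestFixpoint-isTrajectoryGraph {Σ} {Δ} gfp = record
    { fixpoint = Eq.trans (F°Δ≈F°Σ ≤ᴳ-refl) Δ-fix
    -- A fixpoint `Γ` of `F°[ Δ ]` lies above `Δ` by extensivity, so it is also a fixpoint of
    -- `F°[ Σ ]`.
    ; greatest = λ Γ fix →
        greatest gfp Γ (Eq.trans (Eq.sym (F°Δ≈F°Σ (fixpoint-above fix))) fix)
    }
    where
    Δ-fix : F°[ Σ ] Δ ≈ᴳ Δ
    Δ-fix = fixpoint gfp

    F°Δ≈F°Σ : ∀ {Γ} → Δ ≤ᴳ Γ → F°[ Δ ] Γ ≈ᴳ F°[ Σ ] Γ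
    F°Δ≈F°Σ {Γ} Δ≤Γ = antisym
      (F°-least (trans (reflexive (Eq.sym Δ-fix)) (F°-mono (≤ᴳ-refl {Σ}) Δ≤Γ)))
      (F°-mono (fixpoint-above Δ-fix) (≤ᴳ-refl {Γ}))

  -- Since `Σ ≤ᴳ Γ`, the fixpoint `Δ` of `F°[ Σ ]` is a post-fixpoint of `F°[ Γ ]`, whose greatest
  -- fixpoint is `Γ` itself.
  greatestFixpoint≤trajectoryGraph : ∀ {Σ Δ Γ} → F°⟨ Σ ⟩≐ Δ → IsTrajectoryGraph Γ →
                                     Σ ≤ᴳ Γ → Δ ≤ᴳ Γ
  greatestFixpoint≤trajectoryGraph {Δ = Δ} gfp traj Σ≤Γ =
    postfixpoint≤greatestFixpoint traj
      (trans (reflexive (Eq.sym (fixpoint gfp))) (F°-mono Σ≤Γ (≤ᴳ-refl {Δ})))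

proposition5p6 : (C : Circuit) (F : State C → State C) → IsClosureFunction C F →
    (W : Set) (G : AssertionGraph C W) →
    ScalarGSTE F G true ⇔ SimplySatisfies F G
proposition5p6 C F closure W G = mk⇔ sound complete
  where
  open AssertionGraph G
  open Trajectories C shape F
  open IsGreatestFixpoint
  open Poset (graphPoset (Circuit.nodes C) (Shape.edges shape)) using (trans)

  sound : ScalarGSTE F G true → SimplySatisfies F G
  sound (returnsTrue check) φ Σ traj Σ⊨ant e with Δ , lim , cons≤Δ ← check φ =
    ⟦⟧≤⇒⊨ (cons e) (trans cons≤Δ Δ≤Σ e)
    where
    Δ≤Σ : Δ ≤ᴳ Σ
    Δ≤Σ = greatestFixpoint≤trajectoryGraph closure shape
      (limit-isGreatestFixpoint closure shape lim) traj
      (λ e → ⊨⇒⟦⟧≤ (ant e) (Σ⊨ant e))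

  complete : SimplySatisfies F G → ScalarGSTE F G true
  complete sat = returnsTrue check
    where
    check : ∀ φ → ∃[ Δ ] (Δ⋆[ ⟦_⟧ᴳ F G ant φ ]≐ Δ) × ⟦_⟧ᴳ F G cons φ ≤ᴳ Δ
    -- The limit plays two roles: the graph inspected by the algorithm, and the trajectory graph
    -- satisfying `ant` to which `sat` is applied.
    check φ with Δ , lim ← F°Iteration.limit-exists closure shape (⟦_⟧ᴳ F G ant φ) =
      Δ , lim , λ e → ⊨⇒⟦⟧≤ (cons e) (sat φ Δ traj Δ⊨ant e)
      where
      gfp : F°⟨ ⟦_⟧ᴳ F G ant φ ⟩≐ Δ
      gfp = limit-isGreatestFixpoint closure shape lim

      traj : IsTrajectoryGraph Δ
      traj = greatestFixpoint-isTrajectoryGraph closure shape gfp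

      Δ⊨ant : _,_⊨ᴳ_ F G φ Δ ant
      Δ⊨ant e = ⟦⟧≤⇒⊨ (ant e) (fixpoint-above closure shape (fixpoint gfp) e)
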